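{- Let $k\ge 2$ and $m,n\ge k$ be integers, let $J'_k$ be the $k\times k$ matrix whose $1$ entries are exactly at positions $(i,k-i)$ for $1\le i\le k-1$ and $(k,k)$, and let $M$ be an $m\times n$ matrix saturating for $J'_k$, with $S$ the staircase of $M$ all of whose positions are $1$ entries and all of whose below-positions are $0$ entries. Then for all integers $l,i$ with $1\le l\le k-2$ and $l\le i\le m-1$, the leftmost position of level $l$ in the $i$-th row of $M$ is a $1$ entry.
   Context: All matrices are $0$-$1$ matrices; an $m\times n$ matrix has $m$ rows and $n$ columns, with position $(i,j)$ in row $i$, column $j$, rows numbered top to bottom and columns left to right. A matrix $M$ contains a $k\times l$ pattern $P$ if there are rows $r_1<\dots<r_k$ and columns $c_1<\dots<c_l$ with $M(r_a,c_b)=1$ whenever $P(a,b)=1$; $M$ is saturating for $P$ if $M$ avoids $P$ and changing any single $0$ entry of $M$ to $1$ yields a matrix containing $P$. A staircase in an $m\times n$ matrix is a set $S$ of positions containing $(1,n)$ and $(m,1)$ such that for every $p\in S$: exactly one of the positions immediately above and immediately right of $p$ is in $S$ unless $p=(1,n)$, and exactly one of the positions immediately below and immediately left of $p$ is in $S$ unless $p=(m,1)$. A position $(i,j)\notin S$ is below $S$ if some $(i',j)\in S$ has $i'<i$, and above $S$ if it is neither in $S$ nor below $S$. (For $M$ saturating for $J'_k$ there is a unique staircase $S$ whose positions are all $1$ entries and whose below-positions are all $0$ entries.) Level: for a position $p$ above $S$, let $M_p=M$ if $p$ is a $1$ entry and otherwise $M_p$ is $M$ with $p$ changed to $1$. The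 level $l(p)$ is the largest positive integer $l$ for which there exist rows $r_1<\dots<r_l$ and columns $c_1<\dots<c_l$ such that every position $(r_a,c_b)$ ($1\le a,b\le l$) is above $S$, $M_p(r_a,c_{l+1-a})=1$ for all $1\le a\le l$, and $(r_l,c_1)=p$. Positions on or below $S$ have no level. -}

module Defs where

open import Data.Bool using (Bool; true; false; if_then_else_; _∧_; _∨_)
open import Data.Nat using (ℕ; zero; suc; _+_; _∸_; _≤_; _<_; _≡ᵇ_; _≤ᵇ_; _<ᵇ_)
open import Data.Product using (Σ; _×_)
open import Data.Sum using (_⊎_)
open import Relation.Nullary using (¬_)
open import Relation.Binary.PropositionalEquality using (_≡_)

-- Conventions: all indices are 1-based natural numbers, as in the paper.
-- A 0-1 matrix is a function ℕ → ℕ → Bool (true = 1 entry); for an m×n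
-- matrix only the positions (i,j) with 1 ≤ i ≤ m, 1 ≤ j ≤ n matter, and
-- every notion below only ever inspects such positions.
Mat : Set
Mat = ℕ → ℕ → Bool

InRange : ℕ → ℕ → ℕ → ℕ → Set
InRange m n i j = (1 ≤ i × i ≤ m) × (1 ≤ j × j ≤ n)

IncSeq : ℕ → ℕ → (ℕ → ℕ) → Set
IncSeq k m r =
  (∀ a → 1 ≤ a → a ≤ k → 1 ≤ r a × r a ≤ m) ×
  (∀ a → 1 ≤ a → a < k → r a < r (suc a))

Contains : (k l : ℕ) → Mat → (m n : ℕ) → Mat → Set
Contains k l P m n M =
  Σ (ℕ → ℕ) λ r → Σ (ℕ → ℕ) λ c →
    IncSeq k m r × IncSeq l n c ×
    (∀ a b → 1 ≤ a → a ≤ k → 1 ≤ b → b ≤ l →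
       P a b ≡ true → M (r a) (c b) ≡ true)

setOne : Mat → ℕ → ℕ → Mat
setOne M i j a b = if (a ≡ᵇ i) ∧ (b ≡ᵇ j) then true else M a b

Saturating : (k l : ℕ) → Mat → (m n : ℕ) → Mat → Set
Saturating k l P m n M =
  ¬ Contains k l P m n M ×
  (∀ i j → InRange m n i j → M i j ≡ false →
     Contains k l P m n (setOne M i j))

J′ : ℕ → Mat
J′ k a b = ((1 ≤ᵇ a) ∧ (a <ᵇ k) ∧ ((a + b) ≡ᵇ k)) ∨ ((a ≡ᵇ k) ∧ (b ≡ᵇ k))

ExactlyOne : Set → Set → Set
ExactlyOne A B = (A × ¬ B) ⊎ (¬ A × B)

Staircase : (m n : ℕ) → (ℕ → ℕ → Bool) → Set
Staircase m n S =
  (∀ i j → S i j ≡ true → InRange m n i j) ×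
  S 1 n ≡ true × S m 1 ≡ true ×
  (∀ i j → S i j ≡ true → ¬ (i ≡ 1 × j ≡ n) →
     ExactlyOne (S (i ∸ 1) j ≡ true) (S i (suc j) ≡ true)) ×
  (∀ i j → S i j ≡ true → ¬ (i ≡ m × j ≡ 1) →
     ExactlyOne (S (suc i) j ≡ true) (S i (j ∸ 1) ≡ true))

BelowS : (m n : ℕ) → (ℕ → ℕ → Bool) → ℕ → ℕ → Set
BelowS m n S i j =
  InRange m n i j × ¬ (S i j ≡ true) ×
  Σ ℕ λ i′ → i′ < i × S i′ j ≡ true

AboveS : (m n : ℕ) → (ℕ → ℕ → Bool) → ℕ → ℕ → Set
AboveS m n S i j =
  InRange m n i j × ¬ (S i j ≡ true) × ¬ BelowS m n S i j

Mp : Mat → ℕ → ℕ → Mat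
Mp M i j = if M i j then M else setOne M i j

LevelWitness : (m n : ℕ) → Mat → (ℕ → ℕ → Bool) → ℕ → ℕ → ℕ → Set
LevelWitness m n M S pi pj l =
  Σ (ℕ → ℕ) λ r → Σ (ℕ → ℕ) λ c →
    (∀ a → 1 ≤ a → a < l → r a < r (suc a)) ×
    (∀ a → 1 ≤ a → a < l → c a < c (suc a)) ×
    (∀ a b → 1 ≤ a → a ≤ l → 1 ≤ b → b ≤ l → AboveS m n S (r a) (c b)) ×
    (∀ a → 1 ≤ a → a ≤ l → Mp M pi pj (r a) (c (suc l ∸ a)) ≡ true) ×
    r l ≡ pi × c 1 ≡ pj

HasLevel : (m n : ℕ) → Mat → (ℕ → ℕ → Bool) → ℕ → ℕ → ℕ → Set
HasLevel m n M S pi pj l =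
  AboveS m n S pi pj × 1 ≤ l × LevelWitness m n M S pi pj l ×
  (∀ l′ → l < l′ → ¬ LevelWitness m n M S pi pj l′)

{-# OPTIONS --safe #-}
-- Suppose the leftmost position p = (i , j) of level l in row i is a 0. Setting p to 1
-- creates a copy of J′_k, which must use p. Its corner cannot be p, since the staircase
-- has a 1 strictly south-east of p that could replace it; so p is an antidiagonal point,
-- diag a₀. The antidiagonal up to p witnesses level a₀ + 1 for p, hence a₀ < l ≤ k - 2
-- and the antidiagonal continues beyond p. We show that p′ = (i , j - 1) also has level
-- l, contradicting leftmostness. Moving the last point of a witness for p one column left
-- gives a witness for p′. Conversely, let w be a witness for p′ longer than l and B its
-- a₀ + 1 points just before p′; they lie above row i and right of column j - 1. Compare B
-- with the antidiagonal A up to p. If A s ≺ B (s + 1), then B (s + 1), …, B a₀ can replace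
-- A (s + 1), …, A a₀ = p in the copy, which puts J′_k into M; similarly B can replace all
-- of A unless B 0 lies right of the corner. If B s ≺ A s, then w up to B s followed by
-- A s, …, p is a witness for p longer than l. Without such crossings B stays weakly below
-- A (noncrossing-chains), yet B a₀ lies above row i, the row of A a₀.
module Submission where

open import Defs
open import Data.Bool using (Bool; true; false)
open import Data.Bool.Properties using (T-≡; T-∧; T-∨; ¬-not) renaming (_≟_ to _≟ᵇ_)
open import Data.Empty using (⊥; ⊥-elim)
open import Data.Nat
open import Data.Nat.Properties
open import Data.Product
open import Data.Product.Properties using (≡-dec)
open import Data.Sum using (_⊎_; inj₁; inj₂)
open import Function using (_∘_)
open import Function.Bundles using (module Equivalence)
open import Relation.Nullary
open import Relation.Binary.Definitions using (tri<; tri≈; tri>)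
open import Relation.Binary.PropositionalEquality

open Equivalence using (to; from)

Pos : Set
Pos = ℕ × ℕ

row col : Pos → ℕ
row = proj₁
col = proj₂

_≟ₚ_ : (p q : Pos) → Dec (p ≡ q)
_≟ₚ_ = ≡-dec _≟_ _≟_

In : ℕ → ℕ → Pos → Set
In m n q = InRange m n (row q) (col q)

IsOne : Mat → Pos → Set
IsOne M q = M (row q) (col q) ≡ true

infix 4 _≺_ _⊏_

_≺_ : Pos → Pos → Set
p ≺ q = row p < row q × col q < col p

_⊏_ : Pos → Pos → Set
p ⊏ q = row p < row q × col p < col q

≺-trans : ∀ {p q r} → p ≺ q → q ≺ r → p ≺ r
≺-trans (r₁ , c₁) (r₂ , c₂) = <-trans r₁ r₂ , <-trans c₂ c₁

Chain : ℕ → (ℕ → Pos) → Set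
Chain len e = ∀ t → suc t < len → e t ≺ e (suc t)

Each : (Pos → Set) → ℕ → (ℕ → Pos) → Set
Each P len e = ∀ t → t < len → P (e t)

chain-≺ : ∀ {len e} → Chain len e → ∀ {t u} → t < u → u < len → e t ≺ e u
chain-≺ ch {t} {suc u} t<1+u 1+u<len with m≤n⇒m<n∨m≡n (s≤s⁻¹ t<1+u)
... | inj₁ t<u  = ≺-trans (chain-≺ ch t<u (<-trans (n<1+n u) 1+u<len)) (ch u 1+u<len)
... | inj₂ refl = ch t 1+u<len

chain-≼ : ∀ {len e} → Chain len e → ∀ {t u} → t ≤ u → u < len →
          row (e t) ≤ row (e u) × col (e u) ≤ col (e t)
chain-≼ ch t≤u u<len with m≤n⇒m<n∨m≡n t≤u
... | inj₁ t<u  = map <⇒≤ <⇒≤ (chain-≺ ch t<u u<len)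
... | inj₂ refl = ≤-refl , ≤-refl

chain-injective : ∀ {len e} → Chain len e → ∀ {t u} → t < len → u < len →
                  e t ≡ e u → t ≡ u
chain-injective ch {t} {u} t<len u<len et≡eu with <-cmp t u
... | tri< t<u _ _ = contradiction (cong row et≡eu) (<⇒≢ (proj₁ (chain-≺ ch t<u u<len)))
... | tri≈ _ t≡u _ = t≡u
... | tri> _ _ u<t = contradiction (cong row et≡eu) (>⇒≢ (proj₁ (chain-≺ ch u<t t<len)))

chain-prefix : ∀ {len len′ e} → len′ ≤ len → Chain len e → Chain len′ e
chain-prefix len′≤len ch t t<len′ = ch t (<-≤-trans t<len′ len′≤len)

drop : ℕ → (ℕ → Pos) → ℕ → Pos
drop s e t = e (s + t)

drop-chain : ∀ s {len len′ e} → s + len′ ≤ len → Chain len e → Chain len′ (drop s e)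
drop-chain s {len′ = len′} {e} le ch t t<len′ =
  subst (λ u → e (s + t) ≺ e u) (sym (+-suc s t))
    (ch (s + t) (<-≤-trans (subst (_< s + len′) (+-suc s t) (+-monoʳ-< s t<len′)) le))

delay : ℕ → (ℕ → Pos) → ℕ → Pos
delay d e t = e (t ∸ d)

delay-chain : ∀ d {len e} → Chain (suc len) e → ∀ {t} → d ≤ t → t < d + len →
              delay d e t ≺ delay d e (suc t)
delay-chain d {len} {e} ch {t} d≤t t<d+len =
  subst (λ u → e (t ∸ d) ≺ e u) (sym 1+t∸d) (ch (t ∸ d) (s≤s (subst (_≤ len) 1+t∸d
    (m≤n+o⇒m∸n≤o (suc t) d t<d+len))))
  where
  1+t∸d : suc t ∸ d ≡ suc (t ∸ d)
  1+t∸d = +-∸-assoc 1 d≤t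

graft : ℕ → (ℕ → Pos) → (ℕ → Pos) → ℕ → Pos
graft zero    f g t       = g t
graft (suc α) f g zero    = f zero
graft (suc α) f g (suc t) = graft α (f ∘ suc) (g ∘ suc) t

graft-< : ∀ α f g {t} → t < α → graft α f g t ≡ f t
graft-< (suc α) f g {zero}  _         = refl
graft-< (suc α) f g {suc t} (s≤s t<α) = graft-< α (f ∘ suc) (g ∘ suc) t<α

graft-≥ : ∀ α f g {t} → α ≤ t → graft α f g t ≡ g t
graft-≥ zero    f g _         = refl
graft-≥ (suc α) f g (s≤s α≤t) = graft-≥ α (f ∘ suc) (g ∘ suc) α≤t

graft-each : ∀ {P : Pos → Set} α {len f g} → Each P α f →
             (∀ t → α ≤ t → t < len → P (g t)) → Each P len (graft α f g)
graft-each {P} α {f = f} {g} Pf Pg t t<len with t <? α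
... | yes t<α = subst P (sym (graft-< α f g t<α)) (Pf t t<α)
... | no  t≮α = subst P (sym (graft-≥ α f g (≮⇒≥ t≮α))) (Pg t (≮⇒≥ t≮α) t<len)

graft-chain : ∀ α {len f g} → α < len → Chain (suc α) f → f α ≺ g (suc α) →
              (∀ t → α < t → suc t ≤ len → g t ≺ g (suc t)) →
              Chain (suc len) (graft (suc α) f g)
graft-chain zero _ _ junction _ zero _ = junction
graft-chain zero _ _ _ tail (suc t) (s≤s lt) = tail (suc t) (s≤s z≤n) lt
graft-chain (suc α) {suc len} _ ch _ _ zero _ = ch 0 (s≤s (s≤s z≤n))
graft-chain (suc α) {suc len} (s≤s α<len) ch junction tail (suc t) (s≤s lt) =
  graft-chain α α<len (λ u u<α → ch (suc u) (s≤s u<α)) junction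
    (λ u α<u u<len → tail (suc u) (s≤s α<u) (s≤s u<len)) t lt

noncrossing-chains : ∀ a {A B} → Chain (suc a) A → Chain (suc a) B → col (A 0) < col (B 0) →
  (∀ s → s < a → ¬ A s ≺ B (suc s)) → (∀ s → s ≤ a → ¬ B s ≺ A s) →
  ∀ s → s ≤ a → row (A s) ≤ row (B s) × col (A s) < col (B s)
noncrossing-chains a {A} {B} chA chB start no-down no-up = ordered
  where
  rows-ordered : ∀ s → s ≤ a → col (A s) < col (B s) → row (A s) ≤ row (B s)
  rows-ordered s s≤a cols = ≮⇒≥ λ rows → no-up s s≤a (rows , cols)

  ordered : ∀ s → s ≤ a → row (A s) ≤ row (B s) × col (A s) < col (B s)
  ordered zero    _   = rows-ordered 0 z≤n start , start
  ordered (suc s) s<a = rows-ordered (suc s) s<a cols , cols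
    where
    cols : col (A (suc s)) < col (B (suc s))
    cols = <-≤-trans (proj₂ (chA s (s≤s s<a))) (≮⇒≥ λ B-left → no-down s s<a
             (≤-<-trans (proj₁ (ordered s (<⇒≤ s<a))) (proj₁ (chB s (s≤s s<a))) , B-left))

module StaircaseGeometry {m n : ℕ} {S : ℕ → ℕ → Bool} (st : Staircase m n S) where

  staircase-in : ∀ {i j} → S i j ≡ true → InRange m n i j
  staircase-in = proj₁ st _ _

  private
    top-right : S 1 n ≡ true
    top-right = proj₁ (proj₂ st)

    bottom-left : S m 1 ≡ true
    bottom-left = proj₁ (proj₂ (proj₂ st))

    up-or-right : ∀ {i j} → S i j ≡ true → ¬ (i ≡ 1 × j ≡ n) →
                  ExactlyOne (S (i ∸ 1) j ≡ true) (S i (suc j) ≡ true)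
    up-or-right = proj₁ (proj₂ (proj₂ (proj₂ st))) _ _

    down-or-left : ∀ {i j} → S i j ≡ true → ¬ (i ≡ m × j ≡ 1) →
                   ExactlyOne (S (suc i) j ≡ true) (S i (j ∸ 1) ≡ true)
    down-or-left = proj₂ (proj₂ (proj₂ (proj₂ st))) _ _

  walk-right : ∀ {i j y} → S i j ≡ true → j ≤‴ y → y < n →
               ∃[ u ] u ≤ i × S u y ≡ true × S u (suc y) ≡ true
  walk-right {zero} s _ _ = contradiction (proj₁ (proj₁ (staircase-in s))) λ ()
  walk-right {suc i} s j≤y y<n
    with up-or-right s (λ { (_ , j≡n) → <⇒≢ (≤-<-trans (≤‴⇒≤ j≤y) y<n) j≡n })
  ... | inj₁ (up , _) = map₂ (map₁ m≤n⇒m≤1+n) (walk-right up j≤y y<n)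
  ... | inj₂ (_ , right) with j≤y
  ...   | ≤‴-refl     = suc i , ≤-refl , s , right
  ...   | ≤‴-step j<y = walk-right right j<y y<n

  reach-column : ∀ {i j y} → S i j ≡ true → j ≤ y → y ≤ n →
                 ∃[ u ] u ≤ i × S u y ≡ true
  reach-column s j≤y y≤n with m≤n⇒m<n∨m≡n j≤y
  ... | inj₂ refl       = _ , ≤-refl , s
  ... | inj₁ (s≤s j≤y₀) = map₂ (map₂ proj₂) (walk-right s (≤⇒≤‴ j≤y₀) y≤n)

  column-entry : ∀ {u c d} → suc d ≤‴ n → S u d ≡ true → S u (suc d) ≡ true →
                 S c (suc d) ≡ true → u < c → ⊥
  column-entry {u} {suc c} {d} fuel left here there u<1+c
    with down-or-left here (λ { (_ , 1+d≡1) → contradiction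
           (subst (1 ≤_) (suc-injective 1+d≡1) (proj₁ (proj₂ (staircase-in left)))) λ () })
  ... | inj₁ (_ , ¬left) = ¬left left
  ... | inj₂ (¬down , _) with c ≟ u
  ...   | yes refl = ¬down there
  ...   | no c≢u with ≤∧≢⇒< (s≤s⁻¹ u<1+c) (c≢u ∘ sym)
  ...     | u<c with up-or-right there (λ { (1+c≡1 , _) →
                       contradiction (subst (u <_) (suc-injective 1+c≡1) u<c) λ () })
  ...       | inj₁ (up , _) = column-entry fuel left here up u<c
  ...       | inj₂ (_ , right) with fuel
  ...         | ≤‴-reflexive 1+d≡n = <⇒≢ (proj₂ (proj₂ (staircase-in right))) 1+d≡n
  ...         | ≤‴-step fuel′ with walk-right here ≤‴-refl (≤‴⇒≤ fuel′)
  ...           | u′ , u′≤u , left′ , here′ =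
    column-entry fuel′ left′ here′ right (≤-<-trans u′≤u u<1+c)

  staircase-antichain : ∀ {a b c d} → S a b ≡ true → S c d ≡ true → a < c → b < d → ⊥
  staircase-antichain {d = suc d} sab scd a<c (s≤s b≤d) =
    let d<n                   = proj₂ (proj₂ (staircase-in scd))
        u , u≤a , left , here = walk-right sab (≤⇒≤‴ b≤d) d<n
    in column-entry (≤⇒≤‴ d<n) left here scd (≤-<-trans u≤a a<c)

  above-clear : ∀ {x y u} → AboveS m n S x y → u ≤ x → ¬ S u y ≡ true
  above-clear (ir , ¬s , ¬below) u≤x s with m≤n⇒m<n∨m≡n u≤x
  ... | inj₁ u<x  = ¬below (ir , ¬s , _ , u<x , s)
  ... | inj₂ refl = ¬s s

  clear⇒above : ∀ {x y} → InRange m n x y → (∀ {u} → u ≤ x → ¬ S u y ≡ true) →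
                AboveS m n S x y
  clear⇒above ir clear = ir , clear ≤-refl , λ { (_ , _ , _ , u<x , s) → clear (<⇒≤ u<x) s }

  above-downward-closed : ∀ {x y x′ y′} → AboveS m n S x y →
    1 ≤ x′ → x′ ≤ x → 1 ≤ y′ → y′ ≤ y → AboveS m n S x′ y′
  above-downward-closed ab@(((_ , x≤m) , (_ , y≤n)) , _) 1≤x′ x′≤x 1≤y′ y′≤y =
    clear⇒above ((1≤x′ , ≤-trans x′≤x x≤m) , (1≤y′ , ≤-trans y′≤y y≤n))
      λ u≤x′ s → let u′ , u′≤u , s′ = reach-column s y′≤y y≤n
      in above-clear ab (≤-trans u′≤u (≤-trans u≤x′ x′≤x)) s′

  NW-of-unbelow-is-above : ∀ {zr zc x y} → InRange m n zr zc → ¬ BelowS m n S zr zc →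
    1 ≤ x → x < zr → 1 ≤ y → y < zc → AboveS m n S x y
  NW-of-unbelow-is-above {zr} {zc} z-in ¬below 1≤x x<zr 1≤y y<zc =
    clear⇒above ((1≤x , ≤-trans (<⇒≤ x<zr) (proj₂ (proj₁ z-in))) ,
                 (1≤y , ≤-trans (<⇒≤ y<zc) (proj₂ (proj₂ z-in)))) clear
    where
    clear : ∀ {u} → u ≤ _ → ¬ S u _ ≡ true
    clear u≤x s with S zr zc ≟ᵇ true
    ... | yes sz = staircase-antichain s sz (≤-<-trans u≤x x<zr) y<zc
    ... | no ¬sz =
      let u′ , u′≤u , s′ = reach-column s (<⇒≤ y<zc) (proj₂ (proj₂ z-in))
      in ¬below (z-in , ¬sz , u′ , ≤-<-trans u′≤u (≤-<-trans u≤x x<zr) , s′)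

  above⇒staircase-SE : ∀ {x y} → AboveS m n S x y →
                       ∃[ q ] S (row q) (col q) ≡ true × (x , y) ⊏ q
  above⇒staircase-SE {y = y} ab@(((1≤x , _) , (1≤y , y≤n)) , _) with m≤n⇒m<n∨m≡n y≤n
  ... | inj₂ refl = ⊥-elim (above-clear ab 1≤x top-right)
  ... | inj₁ y<n with walk-right bottom-left (≤⇒≤‴ 1≤y) y<n
  ...   | u , _ , s , s′ =
    (u , suc y) , s′ , ≰⇒> (λ u≤x → above-clear ab u≤x s) , ≤-refl

setOne-at : ∀ M i j → setOne M i j i j ≡ true
setOne-at M i j rewrite to T-≡ (≡⇒≡ᵇ i i refl) | to T-≡ (≡⇒≡ᵇ j j refl) = refl

setOne-elsewhere : ∀ M {i j} q → q ≢ (i , j) →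
                   setOne M i j (row q) (col q) ≡ M (row q) (col q)
setOne-elsewhere M {i} {j} (a , b) q≢p with a ≡ᵇ i in a≡ᵇi | b ≡ᵇ j in b≡ᵇj
... | true  | true  =
  ⊥-elim (q≢p (cong₂ _,_ (≡ᵇ⇒≡ a i (from T-≡ a≡ᵇi))
                          (≡ᵇ⇒≡ b j (from T-≡ b≡ᵇj))))
... | true  | false = refl
... | false | _     = refl

setOne-one : ∀ M {i j} q → q ≢ (i , j) → IsOne (setOne M i j) q → IsOne M q
setOne-one M q q≢p one = trans (sym (setOne-elsewhere M q q≢p)) one

Mp-at : ∀ M i j → Mp M i j i j ≡ true
Mp-at M i j with M i j in Mij
... | true  = Mij
... | false = setOne-at M i j

Mp-elsewhere : ∀ M {i j} q → q ≢ (i , j) → Mp M i j (row q) (col q) ≡ M (row q) (col q)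
Mp-elsewhere M {i} {j} q q≢p with M i j
... | true  = refl
... | false = setOne-elsewhere M q q≢p

Mp-one : ∀ M {i j} q → IsOne M q → IsOne (Mp M i j) q
Mp-one M {i} {j} q one with q ≟ₚ (i , j)
... | yes refl = Mp-at M i j
... | no  q≢p  = trans (Mp-elsewhere M q q≢p) one

Mp-of-zero : ∀ M {i j} q → M i j ≡ false → IsOne (setOne M i j) q → IsOne (Mp M i j) q
Mp-of-zero M {i} {j} q Mij≡0 one rewrite Mij≡0 = one

J′-antidiagonal : ∀ {k a} → 1 ≤ a → a < k → J′ k a (k ∸ a) ≡ true
J′-antidiagonal 1≤a a<k =
  to T-≡ (from T-∨ (inj₁ (from T-∧ (≤⇒≤ᵇ 1≤a ,
    from T-∧ (<⇒<ᵇ a<k , ≡⇒≡ᵇ _ _ (m+[n∸m]≡n (<⇒≤ a<k)))))))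

J′-corner : ∀ k → J′ k k k ≡ true
J′-corner k = to T-≡ (from T-∨ (inj₂ (from T-∧ (≡⇒≡ᵇ k k refl , ≡⇒≡ᵇ k k refl))))

J′-ones : ∀ {k a b} → J′ k a b ≡ true →
          (1 ≤ a × a < k × a + b ≡ k) ⊎ (a ≡ k × b ≡ k)
J′-ones {k} {a} {b} one with to T-∨ (from T-≡ one)
... | inj₁ t =
  inj₁ (map (≤ᵇ⇒≤ 1 a) (map (<ᵇ⇒< a k) (≡ᵇ⇒≡ (a + b) k) ∘ to T-∧) (to T-∧ t))
... | inj₂ t = inj₂ (map (≡ᵇ⇒≡ a k) (≡ᵇ⇒≡ b k) (to T-∧ t))

-- A copy of J′ (2 + K₀) in M: diag t is the image of the pattern's 1 in row t + 1.
record J′Copy (m n : ℕ) (M : Mat) (K₀ : ℕ) : Set where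
  field
    diag            : ℕ → Pos
    corner          : Pos
    diag-chain      : Chain (suc K₀) diag
    diag-ones       : Each (IsOne M) (suc K₀) diag
    corner-one      : IsOne M corner
    corner-in       : In m n corner
    diag-row≥1      : 1 ≤ row (diag 0)
    diag-col≥1      : 1 ≤ col (diag K₀)
    diag-row<corner : row (diag K₀) < row corner
    diag-col<corner : col (diag 0) < col corner

  diag-⊏-corner : ∀ {t} → t ≤ K₀ → diag t ⊏ corner
  diag-⊏-corner t≤K₀ =
    ≤-<-trans (proj₁ (chain-≼ diag-chain t≤K₀ ≤-refl)) diag-row<corner ,
    ≤-<-trans (proj₂ (chain-≼ diag-chain z≤n (s≤s t≤K₀))) diag-col<corner

  diag-in : ∀ {t} → t ≤ K₀ → In m n (diag t)
  diag-in t≤K₀ =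
    (≤-trans diag-row≥1 (proj₁ (chain-≼ diag-chain z≤n (s≤s t≤K₀))) ,
     ≤-trans (<⇒≤ (proj₁ (diag-⊏-corner t≤K₀))) (proj₂ (proj₁ corner-in))) ,
    (≤-trans diag-col≥1 (proj₂ (chain-≼ diag-chain t≤K₀ ≤-refl)) ,
     ≤-trans (<⇒≤ (proj₂ (diag-⊏-corner t≤K₀))) (proj₂ (proj₂ corner-in)))

contains⇒copy : ∀ {m n M K₀} → Contains (2 + K₀) (2 + K₀) (J′ (2 + K₀)) m n M →
                J′Copy m n M K₀
contains⇒copy {K₀ = K₀} (r , c , (r-in , r-inc) , (c-in , c-inc) , ones) = record
  { diag            = λ t → r (suc t) , c (suc K₀ ∸ t)
  ; corner          = r (2 + K₀) , c (2 + K₀)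
  ; diag-chain      = λ t 1+t<1+K₀ →
      r-inc (suc t) (s≤s z≤n) (<-trans 1+t<1+K₀ (n<1+n _)) , cols-inc t (s≤s⁻¹ 1+t<1+K₀)
  ; diag-ones       = λ t t<1+K₀ →
      ones (suc t) (suc K₀ ∸ t) (s≤s z≤n) (s≤s (<⇒≤ t<1+K₀)) (m<n⇒0<n∸m t<1+K₀)
        (≤-trans (m∸n≤m _ t) (n≤1+n _)) (J′-antidiagonal (s≤s z≤n) (s≤s t<1+K₀))
  ; corner-one      =
      ones (2 + K₀) (2 + K₀) (s≤s z≤n) ≤-refl (s≤s z≤n) ≤-refl (J′-corner (2 + K₀))
  ; corner-in       = r-in (2 + K₀) (s≤s z≤n) ≤-refl , c-in (2 + K₀) (s≤s z≤n) ≤-refl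
  ; diag-row≥1      = proj₁ (r-in 1 ≤-refl (s≤s z≤n))
  ; diag-col≥1      =
      proj₁ (c-in (suc K₀ ∸ K₀) (m<n⇒0<n∸m (n<1+n K₀))
                  (≤-trans (m∸n≤m _ K₀) (n≤1+n _)))
  ; diag-row<corner = r-inc (suc K₀) (s≤s z≤n) ≤-refl
  ; diag-col<corner = c-inc (suc K₀) (s≤s z≤n) ≤-refl
  }
  where
  cols-inc : ∀ t → t < K₀ → c (K₀ ∸ t) < c (suc K₀ ∸ t)
  cols-inc t t<K₀ = subst (λ b → c (K₀ ∸ t) < c b) (sym (+-∸-assoc 1 (<⇒≤ t<K₀)))
    (c-inc (K₀ ∸ t) (m<n⇒0<n∸m t<K₀)
      (≤-<-trans (m∸n≤m K₀ t) (<-trans (n<1+n K₀) (n<1+n _))))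

-- f 1, …, f K, v: the rows (columns) of a copy of J′ are those of its antidiagonal,
-- then that of its corner.
snoc : ℕ → (ℕ → ℕ) → ℕ → ℕ → ℕ
snoc K f v a with a ≤? K
... | yes _ = f a
... | no  _ = v

snoc-≤ : ∀ {K f v a} → a ≤ K → snoc K f v a ≡ f a
snoc-≤ {K} {a = a} a≤K with a ≤? K
... | yes _   = refl
... | no  a≰K = contradiction a≤K a≰K

snoc-last : ∀ {K f v} → snoc K f v (suc K) ≡ v
snoc-last {K} with suc K ≤? K
... | yes 1+K≤K = contradiction 1+K≤K 1+n≰n
... | no  _     = refl

copy⇒contains : ∀ {m n M K₀} → J′Copy m n M K₀ →
                Contains (2 + K₀) (2 + K₀) (J′ (2 + K₀)) m n M
copy⇒contains {m} {n} {M} {K₀} C =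
  rows , cols , (rows-in , rows-inc) , (cols-in , cols-inc) , ones
  where
  open J′Copy C

  row-of col-of : ℕ → ℕ
  row-of a = row (diag (a ∸ 1))
  col-of b = col (diag (suc K₀ ∸ b))

  rows cols : ℕ → ℕ
  rows = snoc (suc K₀) row-of (row corner)
  cols = snoc (suc K₀) col-of (col corner)

  rows-diag : ∀ {t} → t ≤ K₀ → rows (suc t) ≡ row (diag t)
  rows-diag t≤K₀ = snoc-≤ {suc K₀} {row-of} {row corner} (s≤s t≤K₀)

  rows-last : rows (2 + K₀) ≡ row corner
  rows-last = snoc-last {suc K₀} {row-of} {row corner}

  cols-≤ : ∀ {b} → b ≤ suc K₀ → cols b ≡ col-of b
  cols-≤ = snoc-≤ {suc K₀} {col-of} {col corner}

  cols-last : cols (2 + K₀) ≡ col corner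
  cols-last = snoc-last {suc K₀} {col-of} {col corner}

  cols-diag : ∀ {t} → t ≤ K₀ → cols (suc K₀ ∸ t) ≡ col (diag t)
  cols-diag {t} t≤K₀ =
    trans (cols-≤ (m∸n≤m _ t)) (cong (col ∘ diag) (m∸[m∸n]≡n (m≤n⇒m≤1+n t≤K₀)))

  rows-in : ∀ a → 1 ≤ a → a ≤ 2 + K₀ → 1 ≤ rows a × rows a ≤ m
  rows-in (suc t) _ 1+t≤k with m≤n⇒m<n∨m≡n 1+t≤k
  ... | inj₁ (s≤s (s≤s t≤K₀)) rewrite rows-diag t≤K₀ = proj₁ (diag-in t≤K₀)
  ... | inj₂ refl             rewrite rows-last       = proj₁ corner-in

  rows-inc : ∀ a → 1 ≤ a → a < 2 + K₀ → rows a < rows (suc a)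
  rows-inc (suc t) _ (s≤s 1+t≤1+K₀) with m≤n⇒m<n∨m≡n 1+t≤1+K₀
  ... | inj₁ (s≤s 1+t≤K₀) rewrite rows-diag (<⇒≤ 1+t≤K₀) | rows-diag 1+t≤K₀ =
    proj₁ (diag-chain t (s≤s 1+t≤K₀))
  ... | inj₂ refl rewrite rows-diag (≤-refl {K₀}) | rows-last = diag-row<corner

  cols-in : ∀ b → 1 ≤ b → b ≤ 2 + K₀ → 1 ≤ cols b × cols b ≤ n
  cols-in (suc b) _ 1+b≤k with m≤n⇒m<n∨m≡n 1+b≤k
  ... | inj₁ (s≤s 1+b≤1+K₀) rewrite cols-≤ 1+b≤1+K₀ = proj₂ (diag-in (m∸n≤m K₀ b))
  ... | inj₂ refl           rewrite cols-last       = proj₂ corner-in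

  cols-inc : ∀ b → 1 ≤ b → b < 2 + K₀ → cols b < cols (suc b)
  cols-inc (suc b) _ (s≤s 1+b≤1+K₀) with m≤n⇒m<n∨m≡n 1+b≤1+K₀
  ... | inj₁ (s≤s 1+b≤K₀) rewrite cols-≤ 1+b≤1+K₀ | cols-≤ (s≤s 1+b≤K₀) =
    subst (λ t → col (diag t) < col (diag (K₀ ∸ suc b))) (sym (+-∸-assoc 1 1+b≤K₀))
      (proj₂ (diag-chain (K₀ ∸ suc b) (s≤s (∸-monoʳ-< {o = 0} (s≤s z≤n) 1+b≤K₀))))
  ... | inj₂ refl rewrite cols-≤ (≤-refl {suc K₀}) | cols-last | n∸n≡0 K₀ = diag-col<corner

  ones : ∀ a b → 1 ≤ a → a ≤ 2 + K₀ → 1 ≤ b → b ≤ 2 + K₀ →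
         J′ (2 + K₀) a b ≡ true → M (rows a) (cols b) ≡ true
  ones a b _ _ _ _ one with J′-ones {2 + K₀} {a} {b} one
  ... | inj₂ (refl , refl) rewrite rows-last | cols-last = corner-one
  ... | inj₁ (s≤s {n = t} z≤n , s≤s (s≤s t≤K₀) , 1+t+b≡k) =
    subst₂ (λ x y → M x y ≡ true) (sym (rows-diag t≤K₀))
      (sym (trans (cong cols b≡) (cols-diag t≤K₀))) (diag-ones t (s≤s t≤K₀))
    where
    b≡ : b ≡ suc K₀ ∸ t
    b≡ = trans (sym (m+n∸m≡n t b)) (cong (_∸ t) (suc-injective 1+t+b≡k))

module _ {m n M K₀} (C : J′Copy m n M K₀) where
  open J′Copy C

  with-corner : ∀ {M′ q} → (∀ {t} → t ≤ K₀ → IsOne M′ (diag t)) →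
                In m n q → IsOne M′ q → row (diag K₀) < row q → col (diag 0) < col q →
                J′Copy m n M′ K₀
  with-corner diag-ones′ q-in q-one row< col< = record
    { diag            = diag
    ; corner          = _
    ; diag-chain      = diag-chain
    ; diag-ones       = λ t t<1+K₀ → diag-ones′ (s≤s⁻¹ t<1+K₀)
    ; corner-one      = q-one
    ; corner-in       = q-in
    ; diag-row≥1      = diag-row≥1
    ; diag-col≥1      = diag-col≥1
    ; diag-row<corner = row<
    ; diag-col<corner = col<
    }

  reroute : ∀ {M′ a e} → a < K₀ → Chain (suc a) e → Each (IsOne M′) (suc a) e →
            1 ≤ row (e 0) → col (e 0) < col corner → e a ≺ diag (suc a) →
            (∀ {t} → a < t → t ≤ K₀ → IsOne M′ (diag t)) → IsOne M′ corner →
            J′Copy m n M′ K₀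
  reroute {M′} {a} {e} a<K₀ e-chain e-ones row≥1 col< junction later-ones corner-one′ = record
    { diag            = graft (suc a) e diag
    ; corner          = corner
    ; diag-chain      = graft-chain a a<K₀ e-chain junction
                          λ t _ 1+t≤K₀ → diag-chain t (s≤s 1+t≤K₀)
    ; diag-ones       = graft-each {IsOne M′} (suc a) e-ones
                          λ t a<t t<1+K₀ → later-ones a<t (s≤s⁻¹ t<1+K₀)
    ; corner-one      = corner-one′
    ; corner-in       = corner-in
    ; diag-row≥1      = row≥1
    ; diag-col≥1      = subst (λ q → 1 ≤ col q) (sym tail-kept) diag-col≥1
    ; diag-row<corner = subst (λ q → row q < row corner) (sym tail-kept) diag-row<corner
    ; diag-col<corner = col<
    }
    where
    tail-kept : graft (suc a) e diag K₀ ≡ diag K₀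
    tail-kept = graft-≥ (suc a) e diag a<K₀

module Levels {m n : ℕ} {S : ℕ → ℕ → Bool} (st : Staircase m n S) where
  open StaircaseGeometry st

  -- A level witness of length suc L₀ for p, read as the chain e 0 ≺ … ≺ e L₀ = p of its
  -- 1 entries; all of its grid is above S once the south-east corner (row p , col (e 0)) is.
  record LevelChain (M : Mat) (p : Pos) (L₀ : ℕ) (e : ℕ → Pos) : Set where
    field
      chain  : Chain (suc L₀) e
      last   : e L₀ ≡ p
      ones   : Each (IsOne (Mp M (row p) (col p))) (suc L₀) e
      row≥1  : 1 ≤ row (e 0)
      col≥1  : 1 ≤ col p
      corner : AboveS m n S (row p) (col (e 0))

    before-last : ∀ {t} → t < L₀ → e t ≺ p
    before-last t<L₀ = subst (e _ ≺_) last (chain-≺ chain t<L₀ ≤-refl)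

    ones-before-last : ∀ {t} → t < L₀ → IsOne M (e t)
    ones-before-last {t} t<L₀ =
      trans (sym (Mp-elsewhere M (e t) λ et≡p →
                   <-irrefl (cong row et≡p) (proj₁ (before-last t<L₀))))
            (ones t (m<n⇒m<1+n t<L₀))

    grid-above : ∀ {t u} → t ≤ L₀ → u ≤ L₀ → AboveS m n S (row (e t)) (col (e u))
    grid-above {t} {u} t≤L₀ u≤L₀ = above-downward-closed corner
      (≤-trans row≥1 (proj₁ (chain-≼ chain z≤n (s≤s t≤L₀))))
      (subst (λ q → row (e t) ≤ row q) last (proj₁ (chain-≼ chain t≤L₀ ≤-refl)))
      (≤-trans col≥1
         (subst (λ q → col q ≤ col (e u)) last (proj₂ (chain-≼ chain u≤L₀ ≤-refl))))
      (proj₂ (chain-≼ chain z≤n (s≤s u≤L₀)))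

  witness⇒chain : ∀ {M i j L₀} → LevelWitness m n M S i j (suc L₀) →
                  ∃ (LevelChain M (i , j) L₀)
  witness⇒chain {M} {i} {j} {L₀} (r , c , r-inc , c-inc , above , ones , r-last , c-first) =
    e , record
    { chain  = λ t 1+t<1+L₀ →
        r-inc (suc t) (s≤s z≤n) 1+t<1+L₀ , cols-inc t (s≤s⁻¹ 1+t<1+L₀)
    ; last   = cong₂ _,_ r-last (trans (cong c 1+L₀∸L₀≡1) c-first)
    ; ones   = λ t t<1+L₀ → ones (suc t) (s≤s z≤n) t<1+L₀
    ; row≥1  = proj₁ (proj₁ (proj₁ first))
    ; col≥1  = subst (1 ≤_) c-first (proj₁ (proj₂ (proj₁ first)))
    ; corner = subst (λ x → AboveS m n S x (c (suc L₀))) r-last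
                 (above (suc L₀) (suc L₀) (s≤s z≤n) ≤-refl (s≤s z≤n) ≤-refl)
    }
    where
    e : ℕ → Pos
    e t = r (suc t) , c (suc L₀ ∸ t)

    first : AboveS m n S (r 1) (c 1)
    first = above 1 1 ≤-refl (s≤s z≤n) ≤-refl (s≤s z≤n)

    cols-inc : ∀ t → t < L₀ → c (L₀ ∸ t) < c (suc L₀ ∸ t)
    cols-inc t t<L₀ = subst (λ b → c (L₀ ∸ t) < c b) (sym (+-∸-assoc 1 (<⇒≤ t<L₀)))
      (c-inc (L₀ ∸ t) (m<n⇒0<n∸m t<L₀) (s≤s (m∸n≤m L₀ t)))

    1+L₀∸L₀≡1 : suc L₀ ∸ L₀ ≡ 1
    1+L₀∸L₀≡1 = trans (+-∸-assoc 1 (≤-refl {L₀})) (cong suc (n∸n≡0 L₀))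

  chain⇒witness : ∀ {M i j L₀ e} → LevelChain M (i , j) L₀ e →
                  LevelWitness m n M S i j (suc L₀)
  chain⇒witness {M} {i} {j} {L₀} {e} lc =
    r , c , r-inc , c-inc , above , ones′ , cong row last , cong col last
    where
    open LevelChain lc

    r c : ℕ → ℕ
    r a = row (e (a ∸ 1))
    c b = col (e (suc L₀ ∸ b))

    r-inc : ∀ a → 1 ≤ a → a < suc L₀ → r a < r (suc a)
    r-inc (suc a) _ 1+a<1+L₀ = proj₁ (chain a 1+a<1+L₀)

    c-inc : ∀ b → 1 ≤ b → b < suc L₀ → c b < c (suc b)
    c-inc b 1≤b (s≤s b≤L₀) =
      subst (λ t → col (e t) < col (e (L₀ ∸ b))) (sym (+-∸-assoc 1 b≤L₀))
        (proj₂ (chain (L₀ ∸ b) (s≤s (∸-monoʳ-< {o = 0} 1≤b b≤L₀))))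

    above : ∀ a b → 1 ≤ a → a ≤ suc L₀ → 1 ≤ b → b ≤ suc L₀ →
            AboveS m n S (r a) (c b)
    above (suc a) (suc b) _ (s≤s a≤L₀) _ _ = grid-above a≤L₀ (m∸n≤m L₀ b)

    ones′ : ∀ a → 1 ≤ a → a ≤ suc L₀ →
            Mp M i j (r a) (c (suc (suc L₀) ∸ a)) ≡ true
    ones′ (suc a) _ (s≤s a≤L₀) = subst (λ t → Mp M i j (row (e a)) (col (e t)) ≡ true)
      (sym (m∸[m∸n]≡n (m≤n⇒m≤1+n a≤L₀))) (ones a (s≤s a≤L₀))

  lower-last : ∀ {M p L₀ e c′} → LevelChain M p L₀ e → 1 ≤ c′ → c′ ≤ col p →
               LevelChain M (row p , c′) L₀ (graft L₀ e λ _ → row p , c′)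
  lower-last {M} {p} {zero} {c′ = c′} lc 1≤c′ c′≤col = record
    { chain  = λ { _ (s≤s ()) }
    ; last   = refl
    ; ones   = λ _ _ → Mp-at M (row p) c′
    ; row≥1  = proj₁ (proj₁ (proj₁ corner))
    ; col≥1  = 1≤c′
    ; corner = above-downward-closed corner (proj₁ (proj₁ (proj₁ corner))) ≤-refl 1≤c′
                 (subst (λ q → c′ ≤ col q) (sym last) c′≤col)
    }
    where open LevelChain lc
  lower-last {M} {p} {suc L₁} {e} {c′} lc 1≤c′ c′≤col = record
    { chain  = graft-chain L₁ ≤-refl (chain-prefix (n≤1+n _) chain)
                 (map₂ (≤-<-trans c′≤col) (before-last ≤-refl))
                 λ _ L₁<t 1+t≤1+L₁ → contradiction (s≤s⁻¹ 1+t≤1+L₁) (<⇒≱ L₁<t)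
    ; last   = graft-≥ (suc L₁) e (λ _ → row p , c′) ≤-refl
    ; ones   = graft-each {IsOne (Mp M (row p) c′)} (suc L₁)
                 (λ t t<1+L₁ → Mp-one M (e t) (ones-before-last t<1+L₁))
                 λ _ _ _ → Mp-at M (row p) c′
    ; row≥1  = row≥1
    ; col≥1  = 1≤c′
    ; corner = corner
    }
    where open LevelChain lc

module LeftmostLevel
  {m n K₀ : ℕ} {M : Mat} {S : ℕ → ℕ → Bool} (st : Staircase m n S)
  (S-ones : ∀ i j → S i j ≡ true → M i j ≡ true)
  (below-zeros : ∀ i j → BelowS m n S i j → M i j ≡ false)
  (avoids : ¬ Contains (2 + K₀) (2 + K₀) (J′ (2 + K₀)) m n M)
  {l₀ i j : ℕ} (level : HasLevel m n M S i j (suc l₀)) (l≤K₀ : suc l₀ ≤ K₀)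
  (leftmost : ∀ j′ → j′ < j → ¬ HasLevel m n M S i j′ (suc l₀))
  (p-zero : M i j ≡ false) (C : J′Copy m n (setOne M i j) K₀)
  where

  open StaircaseGeometry st
  open Levels st
  open J′Copy C

  p : Pos
  p = i , j

  p-above : AboveS m n S i j
  p-above = proj₁ level

  1≤i : 1 ≤ i
  1≤i = proj₁ (proj₁ (proj₁ p-above))

  1≤j : 1 ≤ j
  1≤j = proj₁ (proj₂ (proj₁ p-above))

  no-longer-chain : ∀ {L₀ e} → suc l₀ ≤ L₀ → ¬ LevelChain M p L₀ e
  no-longer-chain {L₀} l≤L₀ lc =
    proj₂ (proj₂ (proj₂ level)) (suc L₀) (s≤s l≤L₀) (chain⇒witness lc)

  corner-one-M : corner ≢ p → IsOne M corner
  corner-one-M corner≢p = setOne-one M corner corner≢p corner-one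

  p-not-corner : corner ≢ p
  p-not-corner corner≡p with above⇒staircase-SE p-above
  ... | q , q-S , p⊏q = avoids (copy⇒contains
    (with-corner C diag-ones-M (staircase-in q-S) (S-ones _ _ q-S)
      (<-trans (subst (λ x → row (diag K₀) < row x) corner≡p diag-row<corner) (proj₁ p⊏q))
      (<-trans (subst (λ x → col (diag 0) < col x) corner≡p diag-col<corner) (proj₂ p⊏q))))
    where
    diag-ones-M : ∀ {t} → t ≤ K₀ → IsOne M (diag t)
    diag-ones-M {t} t≤K₀ = setOne-one M (diag t)
      (λ diag≡p → <-irrefl (cong row (trans diag≡p (sym corner≡p)))
                           (proj₁ (diag-⊏-corner t≤K₀)))
      (diag-ones t (s≤s t≤K₀))

  p-on-diag : ∃[ a ] a < suc K₀ × diag a ≡ p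
  p-on-diag with anyUpTo? (λ t → diag t ≟ₚ p) (suc K₀)
  ... | yes found = found
  ... | no ¬found = ⊥-elim (avoids (copy⇒contains
    (with-corner C diag-ones-M corner-in (corner-one-M p-not-corner) diag-row<corner diag-col<corner)))
    where
    diag-ones-M : ∀ {t} → t ≤ K₀ → IsOne M (diag t)
    diag-ones-M {t} t≤K₀ =
      setOne-one M (diag t) (λ eq → ¬found (t , s≤s t≤K₀ , eq)) (diag-ones t (s≤s t≤K₀))

  module OnDiagonal {a₀ : ℕ} (a₀≤K₀ : a₀ ≤ K₀) (at : diag a₀ ≡ p) where

    diag-ones-M : ∀ {t} → t ≤ K₀ → t ≢ a₀ → IsOne M (diag t)
    diag-ones-M {t} t≤K₀ t≢a₀ = setOne-one M (diag t)
      (λ diag≡p → t≢a₀ (chain-injective diag-chain (s≤s t≤K₀) (s≤s a₀≤K₀)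
                                         (trans diag≡p (sym at))))
      (diag-ones t (s≤s t≤K₀))

    diag-prefix : LevelChain M p a₀ diag
    diag-prefix = record
      { chain  = chain-prefix (s≤s a₀≤K₀) diag-chain
      ; last   = at
      ; ones   = λ t t≤a₀ →
          Mp-of-zero M (diag t) p-zero (diag-ones t (<-≤-trans t≤a₀ (s≤s a₀≤K₀)))
      ; row≥1  = diag-row≥1
      ; col≥1  = 1≤j
      ; corner = NW-of-unbelow-is-above corner-in corner-not-below
                   1≤i (subst (λ q → row q < row corner) at (proj₁ (diag-⊏-corner a₀≤K₀)))
                   (proj₁ (proj₂ (diag-in z≤n))) diag-col<corner
      }
      where
      corner-not-below : ¬ BelowS m n S (row corner) (col corner)
      corner-not-below below =
        contradiction (trans (sym (corner-one-M p-not-corner)) (below-zeros _ _ below)) λ ()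

    a₀<l : a₀ < suc l₀
    a₀<l = ≰⇒> λ l≤a₀ → no-longer-chain l≤a₀ diag-prefix

    a₀<K₀ : a₀ < K₀
    a₀<K₀ = <-≤-trans a₀<l l≤K₀

    next : Pos
    next = diag (suc a₀)

    p≺next : p ≺ next
    p≺next = subst (_≺ next) at (diag-chain a₀ (s≤s a₀<K₀))

    1<j : 1 < j
    1<j = ≤-<-trans (proj₁ (proj₂ (diag-in a₀<K₀))) (proj₂ p≺next)

    no-reroute : ∀ {e} → Chain (suc a₀) e → Each (IsOne M) (suc a₀) e →
                 1 ≤ row (e 0) → col (e 0) < col corner → e a₀ ≺ next → ⊥
    no-reroute e-chain e-ones row≥1 col< junction = avoids (copy⇒contains
      (reroute C a₀<K₀ e-chain e-ones row≥1 col< junction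
        (λ a₀<t t≤K₀ → diag-ones-M t≤K₀ (>⇒≢ a₀<t)) (corner-one-M p-not-corner)))

    j′ : ℕ
    j′ = j ∸ 1

    1+j′≡j : suc j′ ≡ j
    1+j′≡j = m+[n∸m]≡n 1≤j

    p′ : Pos
    p′ = i , j′

    module LongerChainAtLeft (off : ℕ) {w : ℕ → Pos} (W : LevelChain M p′ (suc (off + a₀)) w)
                             (longer : suc l₀ ≤ suc (off + a₀)) where
      module W = LevelChain W

      B : ℕ → Pos
      B = drop off w

      B-chain : Chain (suc a₀) B
      B-chain = drop-chain off (≤-trans (≤-reflexive (+-suc off a₀)) (n≤1+n _)) W.chain

      w-before-p : ∀ {t} → t ≤ off + a₀ → row (w t) < i × j ≤ col (w t)
      w-before-p t≤ = map₂ (subst (_≤ _) 1+j′≡j) (W.before-last (s≤s t≤))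

      w-ones : ∀ {t} → t ≤ off + a₀ → IsOne M (w t)
      w-ones t≤ = W.ones-before-last (s≤s t≤)

      B-ones : Each (IsOne M) (suc a₀) B
      B-ones t t<1+a₀ = w-ones (+-monoʳ-≤ off (s≤s⁻¹ t<1+a₀))

      B-row≥1 : 1 ≤ row (B 0)
      B-row≥1 =
        proj₁ (proj₁ (proj₁ (W.grid-above (m≤n⇒m≤1+n (+-monoʳ-≤ off z≤n)) z≤n)))

      B≺next : B a₀ ≺ next
      B≺next = <-trans (proj₁ (w-before-p ≤-refl)) (proj₁ p≺next) ,
               <-≤-trans (proj₂ p≺next) (proj₂ (w-before-p ≤-refl))

      start : col (diag 0) < col (B 0)
      start = <-≤-trans diag-col<corner
        (≮⇒≥ λ B-left → no-reroute B-chain B-ones B-row≥1 B-left B≺next)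

      no-cross-down : ∀ s → s < a₀ → ¬ diag s ≺ B (suc s)
      no-cross-down s s<a₀ junction = no-reroute
        (graft-chain s s<a₀ (chain-prefix (s≤s (<⇒≤ (<-≤-trans s<a₀ a₀≤K₀))) diag-chain)
           junction λ t _ 1+t≤a₀ → B-chain t (s≤s 1+t≤a₀))
        (graft-each {IsOne M} (suc s)
           (λ t t<1+s → let t<a₀ = ≤-<-trans (s≤s⁻¹ t<1+s) s<a₀
                        in diag-ones-M (<⇒≤ (<-≤-trans t<a₀ a₀≤K₀)) (<⇒≢ t<a₀))
           λ t _ t<1+a₀ → B-ones t t<1+a₀)
        diag-row≥1 diag-col<corner
        (subst (_≺ next) (sym (graft-≥ (suc s) diag B s<a₀)) B≺next)

      -- w up to B s, then diag s, …, diag a₀ = p, is a level chain for p longer than l.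
      no-cross-up : ∀ s → s ≤ a₀ → ¬ B s ≺ diag s
      no-cross-up s s≤a₀ junction = no-longer-chain longer record
        { chain  = graft-chain (off + s) (s≤s off+s≤off+a₀)
                     (chain-prefix (m≤n⇒m≤1+n (s≤s off+s≤off+a₀)) W.chain)
                     (subst (λ t → w (off + s) ≺ diag t) (sym (m+n∸m≡n off s)) junction)
                     λ t off+s<t 1+t≤ → delay-chain (suc off) diag-chain
                       (≤-trans (s≤s (m≤m+n off s)) off+s<t)
                       (s≤s (≤-trans (s≤s⁻¹ 1+t≤) (+-monoʳ-≤ off a₀≤K₀)))
        ; last   = trans (graft-≥ (suc (off + s)) w D (s≤s off+s≤off+a₀))
                         (trans (cong diag (m+n∸m≡n off a₀)) at)
        ; ones   = graft-each {IsOne (Mp M i j)} (suc (off + s))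
                     (λ t t<1+off+s →
                        Mp-one M (w t) (w-ones (≤-trans (s≤s⁻¹ t<1+off+s) off+s≤off+a₀)))
                     λ t _ t< → Mp-of-zero M (D t) p-zero (diag-ones _
                       (s≤s (≤-trans (m≤n+o⇒m∸n≤o t (suc off) (s≤s⁻¹ t<)) a₀≤K₀)))
        ; row≥1  = W.row≥1
        ; col≥1  = 1≤j
        ; corner = W.corner
        }
        where
        D : ℕ → Pos
        D = delay (suc off) diag

        off+s≤off+a₀ : off + s ≤ off + a₀
        off+s≤off+a₀ = +-monoʳ-≤ off s≤a₀

      impossible : ⊥
      impossible = <⇒≱ (proj₁ (w-before-p ≤-refl))
        (subst (λ q → row q ≤ row (B a₀)) at
          (proj₁ (noncrossing-chains a₀ (chain-prefix (s≤s a₀≤K₀) diag-chain) B-chain start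
                    no-cross-down no-cross-up a₀ ≤-refl)))

    p′-level : HasLevel m n M S i j′ (suc l₀)
    p′-level =
      above-downward-closed p-above 1≤i ≤-refl 1≤j′ (m∸n≤m j 1) ,
      s≤s z≤n ,
      chain⇒witness (lower-last p-chain 1≤j′ (m∸n≤m j 1)) ,
      no-longer
      where
      1≤j′ : 1 ≤ j′
      1≤j′ = ∸-monoˡ-≤ 1 1<j

      p-chain : LevelChain M p l₀ _
      p-chain = proj₂ (witness⇒chain {M} (proj₁ (proj₂ (proj₂ level))))

      no-longer : ∀ l′ → suc l₀ < l′ → ¬ LevelWitness m n M S i j′ l′
      no-longer (suc L₀) (s≤s l≤L₀) W′
        with m≤n⇒∃[o]m+o≡n (<-≤-trans a₀<l l≤L₀) | witness⇒chain {M} W′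
      ... | off , refl | w , W = LongerChainAtLeft.impossible off
              (subst (λ L → LevelChain M p′ L w) a₀+off≡off+a₀ W)
              (subst (suc l₀ ≤_) a₀+off≡off+a₀ l≤L₀)
        where
        a₀+off≡off+a₀ : suc (a₀ + off) ≡ suc (off + a₀)
        a₀+off≡off+a₀ = cong suc (+-comm a₀ off)

    impossible : ⊥
    impossible = leftmost j′ (subst (j′ <_) 1+j′≡j (n<1+n j′)) p′-level

  impossible : ⊥
  impossible = let _ , a₀<1+K₀ , at = p-on-diag in OnDiagonal.impossible (s≤s⁻¹ a₀<1+K₀) at

lemma3 : (k m n : ℕ) → 2 ≤ k → k ≤ m → k ≤ n →
    (M : Mat) → Saturating k k (J′ k) m n M →
    (S : ℕ → ℕ → Bool) → Staircase m n S →
    (∀ i j → S i j ≡ true → M i j ≡ true) →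
    (∀ i j → BelowS m n S i j → M i j ≡ false) →
    (l i : ℕ) → 1 ≤ l → l ≤ k ∸ 2 → l ≤ i → i ≤ m ∸ 1 →
    (j : ℕ) → HasLevel m n M S i j l →
    (∀ j′ → j′ < j → ¬ HasLevel m n M S i j′ l) →
    M i j ≡ true
lemma3 (suc (suc K₀)) m n (s≤s (s≤s z≤n)) _ _ M (avoids , saturated) S st S-ones below-zeros
       (suc l₀) i (s≤s z≤n) l≤K₀ _ _ j level leftmost with M i j ≟ᵇ true
... | yes one = one
... | no ¬one = ⊥-elim (LeftmostLevel.impossible st S-ones below-zeros avoids level l≤K₀ leftmost
                          Mij≡0 (contains⇒copy (saturated i j (proj₁ (proj₁ level)) Mij≡0)))
  where
  Mij≡0 : M i j ≡ false
  Mij≡0 = ¬-not ¬one
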